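{- For all non-negative integers $n$ and $p$, $$\sum_{k=1}^n\binom{2k}{k}^{ -1}\binom{2(k+p)}{k+p}\binom{k+p}{k}\left(O_{k+p}-O_k\right)=\frac14\binom{2n}{n}^{ -1}\binom{2(n+p+1)}{n+p+1}\binom{n+p+1}{n}\left(O_{n+p+1}-O_n\right)-\frac14\binom{2(p+1)}{p+1}O_{p+1}.$$
   Context: The odd harmonic numbers are $O_n=\sum_{k=1}^n\frac{1}{2k-1}$, $O_0=0$. -}

module Defs where

open import Data.Nat.Base as ℕ using (ℕ; zero; suc; NonZero; >-nonZero)
open import Data.Nat.Combinatorics using (_C_; k![n∸k]!∣n!)
open import Data.Nat.Combinatorics.Specification using (nCk≡n!/k![n-k]!)
open import Data.Nat.Divisibility using (∣⇒≤)
open import Data.Nat.DivMod using (m≥n⇒m/n>0)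
open import Data.Nat.Properties using (_!≢0; _!*_!≢0; m≤m+n)
open import Data.Integer.Base using (+_)
open import Data.Rational.Base using (ℚ; 0ℚ; _+_; _/_)
open import Relation.Binary.PropositionalEquality using (sym; subst)

k≤n⇒nCk≢0 : ∀ {n k} → k ℕ.≤ n → NonZero (n C k)
k≤n⇒nCk≢0 {n} {k} k≤n = subst NonZero (sym (nCk≡n!/k![n-k]! k≤n))
  (>-nonZero (m≥n⇒m/n>0 (∣⇒≤ (k![n∸k]!∣n! k≤n))))
  where instance
    _ = n !≢0
    _ = k !* (n ℕ.∸ k) !≢0

binom : ℕ → ℕ → ℚ
binom n k = + (n C k) / 1

centralBinom⁻¹ : ℕ → ℚ
centralBinom⁻¹ k = + 1 / ((2 ℕ.* k) C k)
  where instance _ = k≤n⇒nCk≢0 (m≤m+n k (k ℕ.+ 0))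

-- Σ₁ n f = f 1 + ⋯ + f n
Σ₁ : ℕ → (ℕ → ℚ) → ℚ
Σ₁ zero    f = 0ℚ
Σ₁ (suc n) f = Σ₁ n f + f (suc n)

-- O n = Σ_{k=1}^{n} 1/(2k-1); the last term of O (suc n) has
-- denominator 2(n+1)-1 = 2n+1.
O : ℕ → ℚ
O zero    = 0ℚ
O (suc n) = O n + + 1 / suc (2 ℕ.* n)

{-# OPTIONS --safe #-}
module Submission where

-- Telescoping in n: writing m = n + p + 1 and u = binom(2n,n)⁻¹ binom(2m,m) binom(m,n),
-- the summand at n + 1 and both values of the closed form are explicit rational
-- multiples of u, and the difference of the closed form is the summand because
-- (2m+1) - (2n+1) = 2(p+1).

open import Defs
open import Data.Nat.Base as ℕ using (ℕ; zero; suc)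
open import Data.Nat.Combinatorics using (_C_; nCk+nC[k+1]≡[n+1]C[k+1]; nCk≡nC[n∸k])
open import Data.Nat.Combinatorics.Specification using (k>n⇒nCk≡0)
import Data.Nat.Properties as ℕ
open import Data.Integer.Base as ℤ using (+_)
import Data.Integer.Properties as ℤ
open import Data.Rational.Base using (ℚ; 0ℚ; 1ℚ; _+_; _-_; _*_; _/_; toℚᵘ)
open import Data.Rational.Properties using (toℚᵘ-injective; toℚᵘ-fromℚᵘ; toℚᵘ-homo-+; toℚᵘ-homo-*; *-identityʳ)
open import Data.Rational.Solver using () renaming (module +-*-Solver to ℚ-Solver)
open import Data.Rational.Unnormalised.Base as ℚᵘ using (mkℚᵘ; *≡*)
import Data.Rational.Unnormalised.Properties as ℚᵘ
open import Relation.Binary.PropositionalEquality using (_≡_; refl; sym; trans; cong; cong₂; module ≡-Reasoning)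

open ≡-Reasoning

-- Recurrences for binomial coefficients in ℕ, kept free of division.

[1+k]*[1+n]C[1+k]≡[1+n]*nCk : ∀ n k → suc k ℕ.* (suc n C suc k) ≡ suc n ℕ.* (n C k)
[1+k]*[1+n]C[1+k]≡[1+n]*nCk zero zero = refl
[1+k]*[1+n]C[1+k]≡[1+n]*nCk zero (suc k) = begin
  suc (suc k) ℕ.* (1 C suc (suc k)) ≡⟨ cong (suc (suc k) ℕ.*_) (k>n⇒nCk≡0 {1} {suc (suc k)} (ℕ.s≤s (ℕ.s≤s ℕ.z≤n))) ⟩
  suc (suc k) ℕ.* 0                 ≡⟨ ℕ.*-zeroʳ (suc (suc k)) ⟩
  0                                 ≡⟨ cong (1 ℕ.*_) (k>n⇒nCk≡0 {0} {suc k} (ℕ.s≤s ℕ.z≤n)) ⟨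
  1 ℕ.* (0 C suc k)                 ∎
[1+k]*[1+n]C[1+k]≡[1+n]*nCk (suc n) zero = begin
  1 ℕ.* (suc (suc n) C 1)                 ≡⟨ cong (1 ℕ.*_) (nCk+nC[k+1]≡[n+1]C[k+1] (suc n) 0) ⟨
  1 ℕ.* (1 ℕ.+ (suc n C 1))               ≡⟨ ℕ.*-distribˡ-+ 1 1 (suc n C 1) ⟩
  1 ℕ.+ 1 ℕ.* (suc n C 1)                 ≡⟨ cong (1 ℕ.+_) ([1+k]*[1+n]C[1+k]≡[1+n]*nCk n zero) ⟩
  suc (suc n) ℕ.* 1                       ∎
[1+k]*[1+n]C[1+k]≡[1+n]*nCk (suc n) (suc k) = begin
  suc (suc k) ℕ.* (suc (suc n) C suc (suc k))
    ≡⟨ cong (suc (suc k) ℕ.*_) (nCk+nC[k+1]≡[n+1]C[k+1] (suc n) (suc k)) ⟨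
  suc (suc k) ℕ.* (X ℕ.+ (suc n C suc (suc k)))
    ≡⟨ ℕ.*-distribˡ-+ (suc (suc k)) X _ ⟩
  X ℕ.+ suc k ℕ.* X ℕ.+ suc (suc k) ℕ.* (suc n C suc (suc k))
    -- Both Pascal summands fall to the induction hypothesis; the spare `X`, split off from
    -- `suc (suc k) ℕ.* X`, later raises the factor `suc n` to `suc (suc n)`.
    ≡⟨ cong₂ (λ s t → X ℕ.+ s ℕ.+ t) ([1+k]*[1+n]C[1+k]≡[1+n]*nCk n k) ([1+k]*[1+n]C[1+k]≡[1+n]*nCk n (suc k)) ⟩
  X ℕ.+ suc n ℕ.* (n C k) ℕ.+ suc n ℕ.* (n C suc k)
    ≡⟨ ℕ.+-assoc X _ _ ⟩
  X ℕ.+ (suc n ℕ.* (n C k) ℕ.+ suc n ℕ.* (n C suc k))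
    ≡⟨ cong (X ℕ.+_) (ℕ.*-distribˡ-+ (suc n) (n C k) (n C suc k)) ⟨
  X ℕ.+ suc n ℕ.* ((n C k) ℕ.+ (n C suc k))
    ≡⟨ cong (λ s → X ℕ.+ suc n ℕ.* s) (nCk+nC[k+1]≡[n+1]C[k+1] n k) ⟩
  suc (suc n) ℕ.* X ∎
  where X = suc n C suc k

-- After adding `suc k ℕ.* Y` to both sides, Pascal's rule and absorption turn the left side into
-- `(suc k ℕ.+ d) ℕ.* Y`. The parameter `d` replaces a truncated difference of the two indices.
[1+k]*[k+d]C[1+k]≡d*[k+d]Ck : ∀ k d → suc k ℕ.* ((k ℕ.+ d) C suc k) ≡ d ℕ.* ((k ℕ.+ d) C k)
[1+k]*[k+d]C[1+k]≡d*[k+d]Ck k d = ℕ.+-cancelˡ-≡ (suc k ℕ.* Y) _ _ (begin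
  suc k ℕ.* Y ℕ.+ suc k ℕ.* (m C suc k) ≡⟨ ℕ.*-distribˡ-+ (suc k) Y _ ⟨
  suc k ℕ.* (Y ℕ.+ (m C suc k))         ≡⟨ cong (suc k ℕ.*_) (nCk+nC[k+1]≡[n+1]C[k+1] m k) ⟩
  suc k ℕ.* (suc m C suc k)             ≡⟨ [1+k]*[1+n]C[1+k]≡[1+n]*nCk m k ⟩
  (suc k ℕ.+ d) ℕ.* Y                   ≡⟨ ℕ.*-distribʳ-+ Y (suc k) d ⟩
  suc k ℕ.* Y ℕ.+ d ℕ.* Y               ∎)
  where
  m = k ℕ.+ d
  Y = m C k

-- Absorption is applied twice. In between, the symmetry of row 2m+1 exchanges its two middle
-- entries, so that the factor m+1 of 2m+2 can be absorbed as well.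
centralBinom-suc : ∀ m →
  suc m ℕ.* ((2 ℕ.* suc m) C suc m) ≡ 2 ℕ.* (suc (2 ℕ.* m) ℕ.* ((2 ℕ.* m) C m))
centralBinom-suc m = begin
  suc m ℕ.* ((2 ℕ.* suc m) C suc m)
    ≡⟨ cong (λ s → suc m ℕ.* (s C suc m)) (ℕ.*-suc 2 m) ⟩
  suc m ℕ.* (suc (suc (2 ℕ.* m)) C suc m)
    ≡⟨ [1+k]*[1+n]C[1+k]≡[1+n]*nCk (suc (2 ℕ.* m)) m ⟩
  suc (suc (2 ℕ.* m)) ℕ.* (suc (2 ℕ.* m) C m)
    ≡⟨ cong₂ ℕ._*_ (sym (ℕ.*-suc 2 m)) middle ⟩
  2 ℕ.* suc m ℕ.* (suc (2 ℕ.* m) C suc m)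
    ≡⟨ ℕ.*-assoc 2 (suc m) _ ⟩
  2 ℕ.* (suc m ℕ.* (suc (2 ℕ.* m) C suc m))
    ≡⟨ cong (2 ℕ.*_) ([1+k]*[1+n]C[1+k]≡[1+n]*nCk (2 ℕ.* m) m) ⟩
  2 ℕ.* (suc (2 ℕ.* m) ℕ.* ((2 ℕ.* m) C m)) ∎
  where
  middle : suc (2 ℕ.* m) C m ≡ suc (2 ℕ.* m) C suc m
  middle = trans (nCk≡nC[n∸k] (ℕ.m≤n⇒m≤1+n (ℕ.m≤m+n m (m ℕ.+ 0))))
    (cong (suc (2 ℕ.* m) C_) (begin
      suc (2 ℕ.* m) ℕ.∸ m      ≡⟨ cong (ℕ._∸ m) (ℕ.+-suc m (m ℕ.+ 0)) ⟨
      m ℕ.+ suc (m ℕ.+ 0) ℕ.∸ m ≡⟨ ℕ.m+n∸m≡n m (suc (m ℕ.+ 0)) ⟩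
      suc (m ℕ.+ 0)            ≡⟨ cong suc (ℕ.+-identityʳ m) ⟩
      suc m                    ∎))

-- Transfer of the recurrences from ℕ to ℚ.

ι : ℕ → ℚ
ι n = + n / 1

-- `_/_` normalises by a gcd that is stuck on variables, so identities about `ι` are checked on
-- unnormalised fractions, where they are integer equations.
toℚᵘ-ι : ∀ n → toℚᵘ (ι n) ℚᵘ.≃ mkℚᵘ (+ n) 0
toℚᵘ-ι n = toℚᵘ-fromℚᵘ (mkℚᵘ (+ n) 0)

ι-homo-+ : ∀ m n → ι (m ℕ.+ n) ≡ ι m + ι n
ι-homo-+ m n = toℚᵘ-injective (ℚᵘ.≃-trans (toℚᵘ-ι (m ℕ.+ n)) (ℚᵘ.≃-trans
  (*≡* (cong (ℤ._* + 1) (cong₂ ℤ._+_ (sym (ℤ.*-identityʳ (+ m))) (sym (ℤ.*-identityʳ (+ n))))))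
  (ℚᵘ.≃-sym (ℚᵘ.≃-trans (toℚᵘ-homo-+ (ι m) (ι n)) (ℚᵘ.+-cong (toℚᵘ-ι m) (toℚᵘ-ι n))))))

ι-homo-* : ∀ m n → ι (m ℕ.* n) ≡ ι m * ι n
ι-homo-* m n = toℚᵘ-injective (ℚᵘ.≃-trans (toℚᵘ-ι (m ℕ.* n)) (ℚᵘ.≃-trans
  (*≡* (cong (ℤ._* + 1) (ℤ.pos-* m n)))
  (ℚᵘ.≃-sym (ℚᵘ.≃-trans (toℚᵘ-homo-* (ι m) (ι n)) (ℚᵘ.*-cong (toℚᵘ-ι m) (toℚᵘ-ι n))))))

1/n*ιn≡1 : ∀ n .{{_ : ℕ.NonZero n}} → (+ 1 / n) * ι n ≡ 1ℚ
1/n*ιn≡1 (suc n) = toℚᵘ-injective (ℚᵘ.≃-trans (toℚᵘ-homo-* (+ 1 / suc n) (ι (suc n))) (ℚᵘ.≃-trans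
  (ℚᵘ.*-cong (toℚᵘ-fromℚᵘ (mkℚᵘ (+ 1) n)) (toℚᵘ-ι (suc n)))
  (ℚᵘ.*-inverseˡ (mkℚᵘ (+ suc n) 0))))

centralBinom⁻¹-inverseˡ : ∀ n → centralBinom⁻¹ n * binom (2 ℕ.* n) n ≡ 1ℚ
centralBinom⁻¹-inverseˡ n = 1/n*ιn≡1 ((2 ℕ.* n) C n) {{k≤n⇒nCk≢0 (ℕ.m≤m+n n (n ℕ.+ 0))}}

-- As `binom n k` unfolds to `ι (n C k)`, this carries the recurrences above over to `binom` without
-- further conversion.
ι-cross-multiply : ∀ a b c d → a ℕ.* b ≡ c ℕ.* d → ι a * ι b ≡ ι c * ι d
ι-cross-multiply a b c d eq = begin
  ι a * ι b   ≡⟨ ι-homo-* a b ⟨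
  ι (a ℕ.* b) ≡⟨ cong ι eq ⟩
  ι (c ℕ.* d) ≡⟨ ι-homo-* c d ⟩
  ι c * ι d   ∎

binom-centralBinom-suc : ∀ m →
  ι (suc m) * binom (2 ℕ.* suc m) (suc m) ≡ ι 2 * (ι (suc (2 ℕ.* m)) * binom (2 ℕ.* m) m)
binom-centralBinom-suc m = begin
  ι (suc m) * binom (2 ℕ.* suc m) (suc m)
    ≡⟨ ι-cross-multiply (suc m) ((2 ℕ.* suc m) C suc m) 2 (suc (2 ℕ.* m) ℕ.* ((2 ℕ.* m) C m)) (centralBinom-suc m) ⟩
  ι 2 * ι (suc (2 ℕ.* m) ℕ.* ((2 ℕ.* m) C m))
    ≡⟨ cong (ι 2 *_) (ι-homo-* (suc (2 ℕ.* m)) ((2 ℕ.* m) C m)) ⟩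
  ι 2 * (ι (suc (2 ℕ.* m)) * binom (2 ℕ.* m) m) ∎

-- This is the reciprocal of the central binomial recurrence. Inserting the units `a * b` and
-- `x * w` produces `ι 2 * (w * b)`, which the recurrence turns into `N * b′`; then `a′ * b′`
-- cancels.
centralBinom⁻¹-suc : ∀ n →
  ι 2 * centralBinom⁻¹ (suc n) ≡ centralBinom⁻¹ n * ι (suc n) * (+ 1 / suc (2 ℕ.* n))
centralBinom⁻¹-suc n = begin
  ι 2 * a′                           ≡⟨ solve 1 (λ a′ → con (ι 2) :* a′ := con (ι 2) :* a′ :* con 1ℚ :* con 1ℚ) refl a′ ⟩
  ι 2 * a′ * 1ℚ * 1ℚ                 ≡⟨ cong₂ (λ s t → ι 2 * a′ * s * t) (centralBinom⁻¹-inverseˡ n) (1/n*ιn≡1 (suc (2 ℕ.* n))) ⟨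
  ι 2 * a′ * (a * b) * (x * w)       ≡⟨ solve 5 (λ a a′ b x w → con (ι 2) :* a′ :* (a :* b) :* (x :* w) := a :* a′ :* x :* (con (ι 2) :* (w :* b))) refl a a′ b x w ⟩
  a * a′ * x * (ι 2 * (w * b))       ≡⟨ cong (a * a′ * x *_) (binom-centralBinom-suc n) ⟨
  a * a′ * x * (N * b′)              ≡⟨ solve 5 (λ a a′ b′ x N → a :* a′ :* x :* (N :* b′) := a :* N :* x :* (a′ :* b′)) refl a a′ b′ x N ⟩
  a * N * x * (a′ * b′)              ≡⟨ cong (a * N * x *_) (centralBinom⁻¹-inverseˡ (suc n)) ⟩
  a * N * x * 1ℚ                     ≡⟨ *-identityʳ (a * N * x) ⟩
  a * N * x                          ∎
  where
  open ℚ-Solver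
  a = centralBinom⁻¹ n
  a′ = centralBinom⁻¹ (suc n)
  b = binom (2 ℕ.* n) n
  b′ = binom (2 ℕ.* suc n) (suc n)
  x = + 1 / suc (2 ℕ.* n)
  w = ι (suc (2 ℕ.* n))
  N = ι (suc n)

-- Telescoping of the sum.

summand : ℕ → ℕ → ℚ
summand p k = centralBinom⁻¹ k * binom (2 ℕ.* (k ℕ.+ p)) (k ℕ.+ p) * binom (k ℕ.+ p) k * (O (k ℕ.+ p) - O k)

-- The closed form without its last term, which does not depend on n and so cancels in differences.
antidifference : ℕ → ℕ → ℚ
antidifference p n = (+ 1 / 4) * centralBinom⁻¹ n * binom (2 ℕ.* (n ℕ.+ p ℕ.+ 1)) (n ℕ.+ p ℕ.+ 1) * binom (n ℕ.+ p ℕ.+ 1) n * (O (n ℕ.+ p ℕ.+ 1) - O n)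

-- Applied with m = n + p + 1 and x = 1/w, y = 1/v, w = 2n+1, v = 2m+1, N = n+1, M = m+1, P = p+1, o = O m, r = O n.
telescoping-algebra : ∀ {a a′ b b′ c c₁ c₂ N M P w v x y : ℚ} (o r : ℚ) →
  ι 2 * a′ ≡ a * N * x → N * c₁ ≡ P * c → N * c₂ ≡ M * c → M * b′ ≡ ι 2 * (v * b) →
  x * w ≡ 1ℚ → y * v ≡ 1ℚ → v ≡ w + ι 2 * P →
  (+ 1 / 4) * a * b * c * (o - r) + a′ * b * c₁ * (o - (r + x))
    ≡ (+ 1 / 4) * a′ * b′ * c₂ * ((o + y) - (r + x))
telescoping-algebra {a} {a′} {b} {b′} {c} {c₁} {c₂} {N} {M} {P} {w} {v} {x} {y} o r
  2a′≡ Nc₁≡ Nc₂≡ Mb′≡ xw≡1 yv≡1 v≡ = begin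
  q * a * b * c * (o - r) + a′ * b * c₁ * (o - (r + x))
    ≡⟨ cong (λ s → q * a * b * c * (o - r) + s) summand≡ ⟩
  q * a * b * c * (o - r) + q * ι 2 * (a * x * b * (P * c)) * (o - (r + x))
    -- Splitting `o - r` as `(o - (r + x)) + x` collects everything over one harmonic difference.
    -- The trailing `1ℚ` is kept to be replaced by `y * v`.
    ≡⟨ solve 7 (λ a b c P x o r →
         con q :* a :* b :* c :* (o :- r) :+ con q :* con (ι 2) :* (a :* x :* b :* (P :* c)) :* (o :- (r :+ x))
         := con q :* a :* b :* c :* ((con 1ℚ :+ con (ι 2) :* P :* x) :* (o :- (r :+ x)) :+ x :* con 1ℚ))
         refl a b c P x o r ⟩
  q * a * b * c * ((1ℚ + ι 2 * P * x) * (o - (r + x)) + x * 1ℚ)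
    -- Here (2m+1)/(2n+1) = 1 + 2(p+1)/(2n+1) enters. Both parts now share the factor `x * v`, and
    -- the leftover `y` advances `o` to the next odd harmonic number.
    ≡⟨ cong₂ (λ s t → q * a * b * c * (s * (o - (r + x)) + x * t)) xv≡ yv≡1 ⟨
  q * a * b * c * (x * v * (o - (r + x)) + x * (y * v))
    ≡⟨ solve 8 (λ a b c v x y o r →
         con q :* a :* b :* c :* (x :* v :* (o :- (r :+ x)) :+ x :* (y :* v))
         := con q :* (a :* x :* c :* (v :* b)) :* ((o :+ y) :- (r :+ x)))
         refl a b c v x y o r ⟩
  q * (a * x * c * (v * b)) * ((o + y) - (r + x))
    ≡⟨ cong (_* ((o + y) - (r + x))) closed≡ ⟨
  q * a′ * b′ * c₂ * ((o + y) - (r + x)) ∎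
  where
  open ℚ-Solver
  q = + 1 / 4
  -- Writing `a′` as `h * (ι 2 * a′)` exposes the product that the hypothesis on `a′` rewrites.
  h = + 1 / 2

  summand≡ : a′ * b * c₁ * (o - (r + x)) ≡ q * ι 2 * (a * x * b * (P * c)) * (o - (r + x))
  summand≡ = cong (_* (o - (r + x))) (begin
    a′ * b * c₁                          ≡⟨ solve 3 (λ a′ b c₁ → a′ :* b :* c₁ := con h :* (con (ι 2) :* a′) :* b :* c₁) refl a′ b c₁ ⟩
    h * (ι 2 * a′) * b * c₁              ≡⟨ cong (λ s → h * s * b * c₁) 2a′≡ ⟩
    h * (a * N * x) * b * c₁             ≡⟨ solve 5 (λ a N x b c₁ → con h :* (a :* N :* x) :* b :* c₁ := con q :* con (ι 2) :* (a :* x :* b :* (N :* c₁))) refl a N x b c₁ ⟩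
    q * ι 2 * (a * x * b * (N * c₁))     ≡⟨ cong (λ s → q * ι 2 * (a * x * b * s)) Nc₁≡ ⟩
    q * ι 2 * (a * x * b * (P * c))      ∎)

  xv≡ : x * v ≡ 1ℚ + ι 2 * P * x
  xv≡ = begin
    x * v                 ≡⟨ cong (x *_) v≡ ⟩
    x * (w + ι 2 * P)     ≡⟨ solve 3 (λ x w P → x :* (w :+ con (ι 2) :* P) := x :* w :+ con (ι 2) :* P :* x) refl x w P ⟩
    x * w + ι 2 * P * x   ≡⟨ cong (λ s → s + ι 2 * P * x) xw≡1 ⟩
    1ℚ + ι 2 * P * x      ∎

  -- A chain of absorptions: `a′` releases `N`, which turns `c₂` into `M * c`; then `M` turns `b′`
  -- into `ι 2 * (v * b)`, and this 2 cancels `h`.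
  closed≡ : q * a′ * b′ * c₂ ≡ q * (a * x * c * (v * b))
  closed≡ = begin
    q * a′ * b′ * c₂                     ≡⟨ solve 3 (λ a′ b′ c₂ → con q :* a′ :* b′ :* c₂ := con q :* con h :* (con (ι 2) :* a′) :* b′ :* c₂) refl a′ b′ c₂ ⟩
    q * h * (ι 2 * a′) * b′ * c₂         ≡⟨ cong (λ s → q * h * s * b′ * c₂) 2a′≡ ⟩
    q * h * (a * N * x) * b′ * c₂        ≡⟨ solve 5 (λ a N x b′ c₂ → con q :* con h :* (a :* N :* x) :* b′ :* c₂ := con q :* con h :* (a :* x :* b′ :* (N :* c₂))) refl a N x b′ c₂ ⟩
    q * h * (a * x * b′ * (N * c₂))      ≡⟨ cong (λ s → q * h * (a * x * b′ * s)) Nc₂≡ ⟩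
    q * h * (a * x * b′ * (M * c))       ≡⟨ solve 5 (λ a x b′ M c → con q :* con h :* (a :* x :* b′ :* (M :* c)) := con q :* con h :* (a :* x :* c :* (M :* b′))) refl a x b′ M c ⟩
    q * h * (a * x * c * (M * b′))       ≡⟨ cong (λ s → q * h * (a * x * c * s)) Mb′≡ ⟩
    q * h * (a * x * c * (ι 2 * (v * b))) ≡⟨ solve 5 (λ a x c v b → con q :* con h :* (a :* x :* c :* (con (ι 2) :* (v :* b))) := con q :* (a :* x :* c :* (v :* b))) refl a x c v b ⟩
    q * (a * x * c * (v * b))            ∎

antidifference-suc : ∀ p n → antidifference p n + summand p (suc n) ≡ antidifference p (suc n)
antidifference-suc p n = begin
  antidifference p n + summand p (suc n)
    -- The summand at `suc n` has index `suc (n ℕ.+ p)`, which must be brought to the form `m`; the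
    -- index `suc n ℕ.+ p ℕ.+ 1` on the right already reduces to `suc m`.
    ≡⟨ cong (λ s → antidifference p n + centralBinom⁻¹ (suc n) * binom (2 ℕ.* s) s * binom s (suc n) * (O s - O (suc n))) (ℕ.+-comm (n ℕ.+ p) 1) ⟨
  antidifference p n + centralBinom⁻¹ (suc n) * binom (2 ℕ.* m) m * binom m (suc n) * (O m - O (suc n))
    ≡⟨ telescoping-algebra
         {centralBinom⁻¹ n} {centralBinom⁻¹ (suc n)} {binom (2 ℕ.* m) m} {binom (2 ℕ.* suc m) (suc m)}
         {binom m n} {binom m (suc n)} {binom (suc m) (suc n)} {ι (suc n)} {ι (suc m)} {ι (p ℕ.+ 1)}
         {ι (suc (2 ℕ.* n))} {ι (suc (2 ℕ.* m))} {+ 1 / suc (2 ℕ.* n)} {+ 1 / suc (2 ℕ.* m)}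
         (O m) (O n)
         (centralBinom⁻¹-suc n)
         (ι-cross-multiply (suc n) (m C suc n) (p ℕ.+ 1) (m C n) step)
         (ι-cross-multiply (suc n) (suc m C suc n) (suc m) (m C n) ([1+k]*[1+n]C[1+k]≡[1+n]*nCk m n))
         (binom-centralBinom-suc m)
         (1/n*ιn≡1 (suc (2 ℕ.* n)))
         (1/n*ιn≡1 (suc (2 ℕ.* m)))
         2m+1≡ ⟩
  antidifference p (suc n) ∎
  where
  m = n ℕ.+ p ℕ.+ 1

  -- Reassociating `m` as `n ℕ.+ (p ℕ.+ 1)` makes `p ℕ.+ 1` the gap `d`.
  step : suc n ℕ.* (m C suc n) ≡ (p ℕ.+ 1) ℕ.* (m C n)
  step rewrite ℕ.+-assoc n p 1 = [1+k]*[k+d]C[1+k]≡d*[k+d]Ck n (p ℕ.+ 1)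

  2m+1≡ : ι (suc (2 ℕ.* m)) ≡ ι (suc (2 ℕ.* n)) + ι 2 * ι (p ℕ.+ 1)
  2m+1≡ = begin
    ι (suc (2 ℕ.* m))                               ≡⟨ cong (λ s → ι (suc (2 ℕ.* s))) (ℕ.+-assoc n p 1) ⟩
    ι (suc (2 ℕ.* (n ℕ.+ (p ℕ.+ 1))))               ≡⟨ cong (λ s → ι (suc s)) (ℕ.*-distribˡ-+ 2 n (p ℕ.+ 1)) ⟩
    ι (suc (2 ℕ.* n) ℕ.+ 2 ℕ.* (p ℕ.+ 1))           ≡⟨ ι-homo-+ (suc (2 ℕ.* n)) (2 ℕ.* (p ℕ.+ 1)) ⟩
    ι (suc (2 ℕ.* n)) + ι (2 ℕ.* (p ℕ.+ 1))         ≡⟨ cong (λ s → ι (suc (2 ℕ.* n)) + s) (ι-homo-* 2 (p ℕ.+ 1)) ⟩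
    ι (suc (2 ℕ.* n)) + ι 2 * ι (p ℕ.+ 1)           ∎

theorem16 : ∀ (n p : ℕ) →
    Σ₁ n (λ k → centralBinom⁻¹ k * binom (2 ℕ.* (k ℕ.+ p)) (k ℕ.+ p) * binom (k ℕ.+ p) k * (O (k ℕ.+ p) - O k))
    ≡ (+ 1 / 4) * centralBinom⁻¹ n * binom (2 ℕ.* (n ℕ.+ p ℕ.+ 1)) (n ℕ.+ p ℕ.+ 1) * binom (n ℕ.+ p ℕ.+ 1) n * (O (n ℕ.+ p ℕ.+ 1) - O n)
    - (+ 1 / 4) * binom (2 ℕ.* (p ℕ.+ 1)) (p ℕ.+ 1) * O (p ℕ.+ 1)
theorem16 zero p =
  -- At n = 0 the inverse central binomial and `binom (p ℕ.+ 1) 0` compute to 1 and `O 0` to 0, so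
  -- the closed form is a difference of equal terms.
  solve 2 (λ b o → con 0ℚ :=
    con (+ 1 / 4) :* con 1ℚ :* b :* con 1ℚ :* (o :- con 0ℚ) :- con (+ 1 / 4) :* b :* o)
    refl (binom (2 ℕ.* (p ℕ.+ 1)) (p ℕ.+ 1)) (O (p ℕ.+ 1))
  where open ℚ-Solver
theorem16 (suc n) p = begin
  Σ₁ n (summand p) + summand p (suc n)     ≡⟨ cong (_+ summand p (suc n)) (theorem16 n p) ⟩
  antidifference p n - e + summand p (suc n)    ≡⟨ solve 3 (λ g e t → g :- e :+ t := g :+ t :- e) refl (antidifference p n) e (summand p (suc n)) ⟩
  antidifference p n + summand p (suc n) - e    ≡⟨ cong (_- e) (antidifference-suc p n) ⟩
  antidifference p (suc n) - e                  ∎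
  where
  open ℚ-Solver
  e = (+ 1 / 4) * binom (2 ℕ.* (p ℕ.+ 1)) (p ℕ.+ 1) * O (p ℕ.+ 1)
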